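{- For every integer $n\ge1$ there is a one-to-one correspondence (bijection) between the set $\mathrm{IPF}(n,n)$ of interval parking functions with $n$ cars and $n$ spots and the set $\mathscr F^e(n+1)$ of edge-labeled spanning trees of $K_{n+1}$.
   Context: Write $[n]=\{1,\dots,n\}$. An interval parking function with $n$ cars and $n$ spots is a pair $(a,b)$ with $a=(a_1,\dots,a_n)$, $b=(b_1,\dots,b_n)\in[n]^n$ such that all cars park in the following process: cars $1,\dots,n$ enter in order a one-way street with spots $1,\dots,n$; car $i$ goes to spot $a_i$ and parks in the first free spot that is $\ge a_i$, provided this spot is $\le b_i$ (car $i$ is only willing to park in the interval $[a_i,b_i]$); otherwise it fails to park. The set of these pairs is $\mathrm{IPF}(n,n)$. $\mathscr F^e(n+1)$ is the set of spanning trees of the complete graph $K_{n+1}$ on vertex set $\{0,1,\dots,n\}$ (rooted at vertex $0$) together with a labeling of the $n$ edges bijectively by $1,\dots,n$. -}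

module Defs where

open import Data.Bool using (Bool; false; T)
open import Data.Fin using (Fin; _≤_; _<_)
open import Data.Fin.Subset using (Subset; ⊥; ⁅_⁆; _∪_; _∈_; _∉_)
open import Data.List using (List; _∷_; _∷ʳ_; length)
open import Data.List.Relation.Unary.Linked using (Linked)
open import Data.List.Relation.Unary.Unique.Propositional using (Unique)
open import Data.Nat as ℕ using (ℕ; suc; pred)
open import Data.Product using (Σ; ∃; _×_; _,_; proj₁; proj₂)
open import Data.Vec using (Vec; []; _∷_; zip)
open import Function using (_⤖_)
open import Function.Bundles using (module Bijection)
open import Level using (0ℓ)
open import Relation.Binary.Bundles using (Setoid)
open import Relation.Binary.Construct.Closure.ReflexiveTransitive using (Star)
open import Relation.Binary.PropositionalEquality
  using (_≡_; refl; sym; trans; subst; setoid)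
open import Relation.Nullary using (¬_)
import Relation.Binary.Construct.On as On

-- The spots 1, …, n are represented by Fin n, in the same order.

record FirstFree {n} (occupied : Subset n) (a s : Fin n) : Set where
  field
    free      : s ∉ occupied
    reachable : a ≤ s
    first     : ∀ t → a ≤ t → t < s → t ∈ occupied

-- AllPark occupied cars: starting from the given occupied spots, each of the
-- cars, entering in order with its pair (aᵢ , bᵢ), succeeds in parking.
data AllPark {n} (occupied : Subset n) :
             ∀ {m} → Vec (Fin n × Fin n) m → Set where
  done : AllPark occupied []
  park : ∀ {m a b} {cars : Vec (Fin n × Fin n) m} (s : Fin n) →
         FirstFree occupied a s → s ≤ b →
         AllPark (occupied ∪ ⁅ s ⁆) cars →
         AllPark occupied ((a , b) ∷ cars)

IntervalParkingFunction : ℕ → ℕ → Set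
IntervalParkingFunction m n =
  Σ (Vec (Fin n) m × Vec (Fin n) m) λ (a , b) → AllPark ⊥ (zip a b)

-- Equality is equality of the pairs (a , b); the parking witness is ignored.
IPF : ℕ → ℕ → Setoid 0ℓ 0ℓ
IPF m n = On.setoid {B = IntervalParkingFunction m n}
                    (setoid (Vec (Fin n) m × Vec (Fin n) m)) proj₁

-- A spanning subgraph of the complete graph on Fin m, which is the same as a
-- simple graph with vertex set Fin m.
record SpanningSubgraph (m : ℕ) : Set where
  field
    adj       : Fin m → Fin m → Bool
    symmetric : ∀ u v → adj u v ≡ adj v u
    loopless  : ∀ v → adj v v ≡ false

  _~_ : Fin m → Fin m → Set
  u ~ v = T (adj u v)

  -- Each undirected edge is represented once, smaller endpoint first.  Both
  -- conditions are propositions, so _≡_ on Edge is equality of endpoints.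
  Edge : Set
  Edge = Σ (Fin m × Fin m) λ (u , v) → u < v × u ~ v

  Connected : Set
  Connected = ∀ u v → Star _~_ u v

  -- The cycle v, v₁, …, vₖ, v with k ≥ 2 is given by v and vs = v₁, …, vₖ.
  record IsCycle (v : Fin m) (vs : List (Fin m)) : Set where
    field
      nondegenerate : 2 ℕ.≤ length vs
      distinct      : Unique (v ∷ vs)
      closedWalk    : Linked _~_ (v ∷ vs ∷ʳ v)

  Acyclic : Set
  Acyclic = ∀ v vs → ¬ IsCycle v vs

  IsTree : Set
  IsTree = Connected × Acyclic

record EdgeLabeledSpanningTree (m : ℕ) : Set where
  field
    graph    : SpanningSubgraph m
    isTree   : SpanningSubgraph.IsTree graph
    labeling : SpanningSubgraph.Edge graph ⤖ Fin (pred m)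

  open SpanningSubgraph graph public

  label : Edge → Fin (pred m)
  label = Bijection.to labeling

-- Same edge set and same label on every edge; proofs are ignored.
record _≈ᵗ_ {m} (S T : EdgeLabeledSpanningTree m) : Set where
  private
    module S = EdgeLabeledSpanningTree S
    module T = EdgeLabeledSpanningTree T
  field
    sameAdj   : ∀ u v → S.adj u v ≡ T.adj u v
    sameLabel : ∀ (e : S.Edge) (f : T.Edge) → proj₁ e ≡ proj₁ f →
                S.label e ≡ T.label f

private
  module _ {m : ℕ} where
    open EdgeLabeledSpanningTree using (label)
    open import Data.Bool.Properties using (T-irrelevant)
    open import Data.Nat.Properties using (<-irrelevant)
    open import Relation.Binary.PropositionalEquality using (cong; cong₂)
    open _≈ᵗ_

    ≈ᵗ-refl : {S : EdgeLabeledSpanningTree m} → S ≈ᵗ S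
    ≈ᵗ-refl {S} = record
      { sameAdj   = λ _ _ → refl
      ; sameLabel = λ { (uv , p , x) (_ , q , y) refl →
          cong (λ z → label S (uv , z))
               (cong₂ _,_ (<-irrelevant p q) (T-irrelevant x y)) }
      }

    ≈ᵗ-sym : {S T : EdgeLabeledSpanningTree m} → S ≈ᵗ T → T ≈ᵗ S
    ≈ᵗ-sym S≈T = record
      { sameAdj   = λ u v → sym (sameAdj S≈T u v)
      ; sameLabel = λ e f e≡f → sym (sameLabel S≈T f e (sym e≡f))
      }

    ≈ᵗ-trans : {S T U : EdgeLabeledSpanningTree m} →
               S ≈ᵗ T → T ≈ᵗ U → S ≈ᵗ U
    ≈ᵗ-trans S≈T T≈U = record
      { sameAdj   = λ u v → trans (sameAdj S≈T u v) (sameAdj T≈U u v)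
      ; sameLabel = λ { e@((u , v) , u<v , u~v) f e≡f →
          let g = (u , v) , u<v , subst T (sameAdj S≈T u v) u~v in
          trans (sameLabel S≈T e g refl) (sameLabel T≈U g f e≡f) }
      }

-- 𝓕ᵉ m: spanning trees of the complete graph on the vertices 0, …, m - 1, with
-- edges labeled bijectively by Fin (m - 1), standing for 1, …, m - 1.  The
-- root is always the vertex 0, so it contributes no data.
𝓕ᵉ : ℕ → Setoid 0ℓ 0ℓ
𝓕ᵉ m = record
  { Carrier       = EdgeLabeledSpanningTree m
  ; _≈_           = _≈ᵗ_
  ; isEquivalence = record
    { refl = ≈ᵗ-refl ; sym = ≈ᵗ-sym ; trans = ≈ᵗ-trans }
  }

{-# OPTIONS --safe #-}

-- Let car i park in the spot s i. Hang the vertex of car i below the car in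
-- the spot just before a i, or below the root 0 if a i is the first spot.
-- Parking car i in the first free spot says that a car j with
-- a i ≤ s j < s i arrived earlier, j < i; hence visiting the vertices in the
-- order of their spots is the greedy exploration of the tree that always
-- continues with the smallest label available. Every connected graph has
-- exactly one such exploration, so the tree determines s and then a. The
-- bounds b i ≥ s i, read in the order of the spots, are a sequence c with
-- c t ≥ t, which is the Lehmer code of a permutation; it labels the edges from
-- the vertices to their parents.

module Submission where

open import Defs
open import Data.Nat using (ℕ; suc; _≥_)
open import Function.Bundles using (Bijection)

open import Data.Bool using (T; T?; _∨_)
open import Data.Bool.Properties using (T-∨; T-≡; T-irrelevant; ⇔→≡; ∨-comm)
open import Data.Empty using (⊥; ⊥-elim)
open import Data.Fin using (Fin; zero; suc; toℕ; fromℕ<; inject₁; punchIn; punchOut; _≟_; _≤_; _<_)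
open import Data.Fin.Properties
  using (any?; <-cmp; <-asym; <-irrefl; <-irrelevant; injective⇒≤; punchIn-injective; punchIn-punchOut;
         punchInᵢ≢i; punchOut-injective; suc-injective; toℕ-fromℕ<; toℕ-inject₁; toℕ-injective; toℕ<n; ≤∧≢⇒<)
import Data.Fin.Subset as Subset
open import Data.Fin.Subset using (Subset)
open import Data.Fin.Subset.Properties using (x∈p∪q⁺; x∈p∪q⁻; x∈⁅x⁆; x∈⁅y⁆⇒x≡y; ∉⊥)
open import Data.List using ([]; _∷_; _∷ʳ_)
open import Data.List.Membership.Propositional using (_∈_)
open import Data.List.Relation.Unary.All as All using (All; []; _∷_)
open import Data.List.Relation.Unary.AllPairs using (_∷_)
open import Data.List.Relation.Unary.Any using (here; there)
open import Data.List.Relation.Unary.Linked using (Linked; _∷_)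
open import Data.List.Relation.Unary.Unique.Propositional using (Unique)
import Data.Nat as ℕ
open import Data.Nat using (zero; z≤n; s≤s)
import Data.Nat.Properties as ℕₚ
open import Data.Nat.Induction using (<-rec)
open import Data.Product using (Σ; ∃; _×_; _,_; proj₁; proj₂)
open import Data.Sum using (_⊎_; inj₁; inj₂; [_,_]′)
open import Data.Vec using (Vec; []; _∷_; lookup; tabulate; zip)
open import Data.Vec.Functional using (updateAt)
open import Data.Vec.Functional.Properties using (updateAt-updates; updateAt-minimal)
open import Data.Vec.Properties using (lookup∘tabulate; tabulate∘lookup; tabulate-cong)
open import Function using (_∘_; const; mk⇔; mk⤖)
open import Function.Bundles using (Equivalence)
open import Function.Consequences.Propositional using (strictlySurjective⇒surjective)
open import Function.Definitions using (Injective; StrictlySurjective)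
open import Level using (0ℓ)
open import Relation.Binary using (Rel; Setoid; tri<; tri≈; tri>)
open import Relation.Binary.Construct.Closure.ReflexiveTransitive as Star using (Star; ε; _◅_; _◅◅_)
open import Relation.Binary.PropositionalEquality
  using (_≡_; _≢_; _≗_; refl; sym; trans; cong; cong₂; subst; subst₂)
open import Relation.Nullary using (¬_; Dec; yes; no; does; contradiction)
open import Relation.Nullary.Decidable using (_×-dec_; dec-true; dec-false)
open import Relation.Unary using (Pred; Decidable)

-- Finite sets

-- If `y` were missed, punching it out would inject `Fin (suc n)` into `Fin n`.
injective⇒strictlySurjective : ∀ {n} {f : Fin n → Fin n} →
  Injective _≡_ _≡_ f → StrictlySurjective _≡_ f
injective⇒strictlySurjective {suc n} {f} inj y with any? (λ x → f x ≟ y)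
... | yes hit = hit
... | no miss = contradiction
  (injective⇒≤ {f = λ x → punchOut (avoid x)} λ eq → inj (punchOut-injective (avoid _) (avoid _) eq))
  ℕₚ.1+n≰n
  where
  avoid : ∀ x → y ≢ f x
  avoid x y≡fx = miss (x , sym y≡fx)

least : ∀ {n} {P : Pred (Fin n) 0ℓ} → Decidable P → ∃ P →
  ∃ λ i → P i × (∀ j → P j → i ≤ j)
least {suc n} P? (x , px) with P? zero
... | yes p₀ = zero , p₀ , λ _ _ → z≤n
... | no ¬p₀ with x
...   | zero = contradiction px ¬p₀
...   | suc y with least (P? ∘ suc) (y , px)
...     | i , pi , min = suc i , pi , λ where
            zero p → contradiction p ¬p₀
            (suc j) p → s≤s (min j p)

-- Outcomes of the parking process

-- The process described by its outcome `s` alone: a spot that car `i` passed over was occupied at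
-- the start or taken by an earlier car.
record Parks {n m} (occupied : Subset n) (a b : Fin m → Fin n) (s : Fin m → Fin n) : Set where
  field
    free      : ∀ i → s i Subset.∉ occupied
    injective : Injective _≡_ _≡_ s
    reachable : ∀ i → a i ≤ s i
    willing   : ∀ i → s i ≤ b i
    first     : ∀ i t → a i ≤ t → t < s i → t Subset.∈ occupied ⊎ ∃ λ j → j < i × s j ≡ t

spot : ∀ {n m} {occupied : Subset n} {cars : Vec (Fin n × Fin n) m} →
  AllPark occupied cars → Fin m → Fin n
spot (park s _ _ _)    zero    = s
spot (park _ _ _ rest) (suc i) = spot rest i

spot-parks : ∀ {n m} {occupied : Subset n} (a b : Vec (Fin n) m)
  (p : AllPark occupied (zip a b)) → Parks occupied (lookup a) (lookup b) (spot p)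
spot-parks [] [] p = record
  { free = λ () ; injective = λ {} ; reachable = λ () ; willing = λ () ; first = λ () }
spot-parks {occupied = occ} (x ∷ a) (y ∷ b) (park s ff s≤y rest) = record
  { free = λ where
      zero → FirstFree.free ff
      (suc i) s∈ → R.free i (x∈p∪q⁺ (inj₁ s∈))
  ; injective = injective _ _
  ; reachable = λ where
      zero → FirstFree.reachable ff
      (suc i) → R.reachable i
  ; willing = λ where
      zero → s≤y
      (suc i) → R.willing i
  ; first = λ where
      zero t x≤t t<s → inj₁ (FirstFree.first ff t x≤t t<s)
      (suc i) t x≤t t<s → later i t (R.first i t x≤t t<s)
  }
  where
  module R = Parks (spot-parks a b rest)
  fresh : ∀ i → spot rest i ≢ s
  fresh i eq = R.free i (x∈p∪q⁺ (inj₂ (subst (Subset._∈ Subset.⁅ s ⁆) (sym eq) (x∈⁅x⁆ s))))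
  injective : ∀ i j → spot (park {a = x} s ff s≤y rest) i ≡ spot (park {a = x} s ff s≤y rest) j → i ≡ j
  injective zero    zero    _  = refl
  injective zero    (suc j) eq = contradiction (sym eq) (fresh j)
  injective (suc i) zero    eq = contradiction eq (fresh i)
  injective (suc i) (suc j) eq = cong suc (R.injective eq)
  later : ∀ i t → t Subset.∈ (occ Subset.∪ Subset.⁅ s ⁆) ⊎ (∃ λ j → j < i × spot rest j ≡ t) →
    t Subset.∈ occ ⊎ ∃ λ j → j < suc i × spot (park {a = x} s ff s≤y rest) j ≡ t
  later i t (inj₂ (j , j<i , eq)) = inj₂ (suc j , s≤s j<i , eq)
  later i t (inj₁ t∈) with x∈p∪q⁻ occ _ t∈
  ... | inj₁ t∈occ = inj₁ t∈occ
  ... | inj₂ t∈s = inj₂ (zero , s≤s z≤n , sym (x∈⁅y⁆⇒x≡y s t∈s))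

parks⇒allPark : ∀ {n m} {occupied : Subset n} (a b : Vec (Fin n) m) {s} →
  Parks occupied (lookup a) (lookup b) s → AllPark occupied (zip a b)
parks⇒allPark [] [] _ = done
parks⇒allPark {occupied = occ} (x ∷ a) (y ∷ b) {s} P =
  park (s zero)
    (record { free = P.free zero ; reachable = P.reachable zero
            ; first = λ t x≤t t<s → [ (λ t∈ → t∈) , (λ ()) ∘ proj₁ ∘ proj₂ ]′ (P.first zero t x≤t t<s) })
    (P.willing zero)
    (parks⇒allPark a b {s ∘ suc} record
      { free = λ i s∈ → [ P.free (suc i) , (λ s∈ → contradiction (P.injective (x∈⁅y⁆⇒x≡y _ s∈)) λ ()) ]′
                          (x∈p∪q⁻ occ _ s∈)
      ; injective = suc-injective ∘ P.injective
      ; reachable = P.reachable ∘ suc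
      ; willing = P.willing ∘ suc
      ; first = λ i t x≤t t<s → later i t (P.first (suc i) t x≤t t<s)
      })
  where
  module P = Parks P
  later : ∀ i t → t Subset.∈ occ ⊎ (∃ λ j → j < suc i × s j ≡ t) →
    t Subset.∈ (occ Subset.∪ Subset.⁅ s zero ⁆) ⊎ ∃ λ j → j < i × s (suc j) ≡ t
  later i t (inj₁ t∈) = inj₁ (x∈p∪q⁺ (inj₁ t∈))
  later i t (inj₂ (zero , _ , refl)) = inj₁ (x∈p∪q⁺ (inj₂ (x∈⁅x⁆ t)))
  later i t (inj₂ (suc j , s≤s j<i , eq)) = inj₂ (j , j<i , eq)

-- Strong induction on the car. If `s i < s′ i`, the second outcome passes over `s i`, so an earlier
-- car holds it there; by induction that car holds it in the first outcome too, against injectivity.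
parks-unique : ∀ {n m} {occupied : Subset n} {a b s s′ : Fin m → Fin n} →
  Parks occupied a b s → Parks occupied a b s′ → s ≗ s′
parks-unique {m = m} {occ} {a} {b} P Q i =
  <-rec (λ k → ∀ {s s′} → Parks occ a b s → Parks occ a b s′ → ∀ i → toℕ i ≡ k → s i ≡ s′ i)
    (λ k rec {s} {s′} P Q i i≡k → go rec P Q i i≡k) (toℕ i) P Q i refl
  where
  module _ {k} (rec : ∀ {j} → j ℕ.< k → ∀ {s s′} → Parks occ a b s → Parks occ a b s′ →
                      ∀ i → toℕ i ≡ j → s i ≡ s′ i) where
    not-before : ∀ {s s′} → Parks occ a b s → Parks occ a b s′ → ∀ i → toℕ i ≡ k → ¬ s i < s′ i
    not-before {s} {s′} P Q i refl lt with Parks.first Q i (s i) (Parks.reachable P i) lt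
    ... | inj₁ s∈ = Parks.free P i s∈
    ... | inj₂ (j , j<i , eq) = <-irrefl (Parks.injective P (trans (rec j<i P Q j refl) eq)) j<i

    go : ∀ {s s′} → Parks occ a b s → Parks occ a b s′ → ∀ i → toℕ i ≡ k → s i ≡ s′ i
    go {s} {s′} P Q i i≡k with <-cmp (s i) (s′ i)
    ... | tri< lt _ _ = contradiction lt (not-before P Q i i≡k)
    ... | tri≈ _ eq _ = eq
    ... | tri> _ _ gt = contradiction gt (not-before Q P i i≡k)

-- Lehmer codes

-- The second argument is a junk value for lower zero; it does not occur when t ≤ c t.
lower : ∀ {n} → Fin (suc n) → Fin n → Fin n
lower zero    d = d
lower (suc x) _ = x

-- When `t ≤ c t`, the difference of `c t` and `t` is the usual Lehmer digit: the rank of the value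
-- at `t` among the values not yet used.
decode : ∀ {n} → (Fin n → Fin n) → Fin n → Fin n
decode c zero    = c zero
decode c (suc t) = punchIn (c zero) (decode (λ t → lower (c (suc t)) t) t)

decode-injective : ∀ {n} (c : Fin n → Fin n) → Injective _≡_ _≡_ (decode c)
decode-injective c {zero} {zero} _ = refl
decode-injective c {zero} {suc j} eq = contradiction (sym eq) (punchInᵢ≢i _ _)
decode-injective c {suc i} {zero} eq = contradiction eq (punchInᵢ≢i _ _)
decode-injective c {suc i} {suc j} eq = cong suc (decode-injective _ (punchIn-injective (c zero) _ _ eq))

decode-cong : ∀ {n} {c d : Fin n → Fin n} → c ≗ d → decode c ≗ decode d
decode-cong c≗d zero = c≗d zero
decode-cong c≗d (suc t) =
  cong₂ punchIn (c≗d zero) (decode-cong (λ t → cong (λ x → lower x t) (c≗d (suc t))) t)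

lower-suc : ∀ {n} (x : Fin (suc n)) (t : Fin n) → suc t ≤ x → suc (lower x t) ≡ x
lower-suc (suc x) t _ = refl

-- The first values agree, so the same `punchIn` cancels from all later ones. The bounds keep
-- `lower` away from its junk value, where it would lose information.
decode-determines : ∀ {n} {c d : Fin n → Fin n} → (∀ t → t ≤ c t) → (∀ t → t ≤ d t) →
  decode c ≗ decode d → c ≗ d
decode-determines _ _ eq zero = eq zero
decode-determines {suc n} {c} {d} t≤c t≤d eq (suc t) = trans (sym (lower-suc _ t (t≤c (suc t)))) (trans
  (cong suc (decode-determines (lowered c t≤c) (lowered d t≤d)
    (λ t → punchIn-injective (c zero) _ _ (trans (eq (suc t)) (cong (λ x → punchIn x _) (sym (eq zero))))) t))
  (lower-suc _ t (t≤d (suc t))))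
  where
  lowered : (c : Fin (suc n) → Fin (suc n)) → (∀ t → t ≤ c t) → ∀ t → t ≤ lower (c (suc t)) t
  lowered c t≤c t with c (suc t) | t≤c (suc t)
  ... | suc x | s≤s t≤x = t≤x

encode : ∀ {n} (p : Fin n → Fin n) → Injective _≡_ _≡_ p →
  ∃ λ c → (∀ t → t ≤ c t) × decode c ≗ p
encode {zero} p _ = p , (λ ()) , λ ()
encode {suc n} p inj
  with encode (λ t → punchOut (avoid t)) (λ eq → suc-injective (inj (punchOut-injective (avoid _) (avoid _) eq)))
  where
  avoid : ∀ t → p zero ≢ p (suc t)
  avoid t eq = contradiction (inj eq) λ ()
... | c , t≤c , dec = c⁺ , t≤c⁺ , dec⁺
  where
  c⁺ : Fin (suc n) → Fin (suc n)
  c⁺ zero    = p zero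
  c⁺ (suc t) = suc (c t)
  t≤c⁺ : ∀ t → t ≤ c⁺ t
  t≤c⁺ zero    = z≤n
  t≤c⁺ (suc t) = s≤s (t≤c t)
  dec⁺ : decode c⁺ ≗ p
  dec⁺ zero    = refl
  dec⁺ (suc t) = trans (cong (punchIn (p zero)) (dec t)) (punchIn-punchOut _)

-- Explorations of a graph from the root

-- The root gets time 0 and all other vertices move up by one, so `time r p ℕ.≤ r i` says that `p`
-- is visited strictly before `suc i`.
time : ∀ {n} → (Fin n → ℕ) → Fin (suc n) → ℕ
time r zero    = 0
time r (suc i) = suc (r i)

time-cong : ∀ {n} {r r′ : Fin n → ℕ} → r ≗ r′ → time r ≗ time r′
time-cong r≗r′ zero    = refl
time-cong r≗r′ (suc i) = cong suc (r≗r′ i)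

time-injective : ∀ {n} {r : Fin n → ℕ} → Injective _≡_ _≡_ r → Injective _≡_ _≡_ (time r)
time-injective inj {zero} {zero} _ = refl
time-injective inj {suc i} {suc j} eq = cong suc (inj (ℕₚ.suc-injective eq))

-- Among the unvisited neighbours of the visited vertices the one with the
-- smallest label is visited next.
record Exploration {n} (_~_ : Rel (Fin (suc n)) 0ℓ) (r : Fin n → ℕ) : Set where
  field
    bounded   : ∀ i → r i ℕ.< n
    injective : Injective _≡_ _≡_ r
    entered   : ∀ i → ∃ λ p → p ~ suc i × time r p ℕ.≤ r i
    greedy    : ∀ {p i j} → p ~ suc i → time r p ℕ.≤ r j → r j ℕ.< r i → j < i

  hits : ∀ {t} → t ℕ.< n → ∃ λ i → r i ≡ t
  hits t<n with injective⇒strictlySurjective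
                  (λ {i} {j} eq → injective (trans (sym (toℕ-fromℕ< (bounded i)))
                    (trans (cong toℕ eq) (toℕ-fromℕ< (bounded j))))) (fromℕ< t<n)
  ... | i , eq = i , trans (sym (toℕ-fromℕ< (bounded i))) (trans (cong toℕ eq) (toℕ-fromℕ< t<n))

-- If i and j are the t-th vertices of two explorations, which agree before
-- t, then i was available when j was chosen and conversely; so i = j.
exploration-unique : ∀ {n} {_~_ : Rel (Fin (suc n)) 0ℓ} {r r′ : Fin n → ℕ} →
  Exploration _~_ r → Exploration _~_ r′ → r ≗ r′
exploration-unique {n} {_~_} {r} {r′} E E′ i = agree (r i) i refl
  where
  module E  = Exploration E
  module E′ = Exploration E′

  Agree : ℕ → Set
  Agree t = ∀ i → r i ≡ t → r i ≡ r′ i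

  module _ {t} (rec : ∀ {u} → u ℕ.< t → Agree u) where
    earlier : ∀ x → r x ℕ.< t → r x ≡ r′ x
    earlier x lt = rec lt x refl

    earlier′ : ∀ x → r′ x ℕ.< t → r x ≡ r′ x
    earlier′ x lt with E.hits (E′.bounded x)
    ... | y , eq = subst (λ z → r z ≡ r′ z) (E′.injective (trans (sym (earlier y ry<t)) eq)) (earlier y ry<t)
      where ry<t = subst (ℕ._< t) (sym eq) lt

    time-earlier : ∀ p → time r p ℕ.≤ t → time r p ≡ time r′ p
    time-earlier zero    _  = refl
    time-earlier (suc x) lt = cong suc (earlier x lt)

    time-earlier′ : ∀ p → time r′ p ℕ.≤ t → time r p ≡ time r′ p
    time-earlier′ zero    _  = refl
    time-earlier′ (suc x) lt = cong suc (earlier′ x lt)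

    go : Agree t
    go i refl with E′.hits (E.bounded i)
    ... | j , r′j≡ri with i ≟ j
    ...   | yes refl = sym r′j≡ri
    ...   | no i≢j = ⊥-elim (<-asym j<i i<j)
      where
      ri<rj : r i ℕ.< r j
      ri<rj with ℕₚ.<-cmp (r i) (r j)
      ... | tri< lt _ _ = lt
      ... | tri≈ _ eq _ = contradiction (E.injective eq) i≢j
      ... | tri> _ _ gt = contradiction (trans (earlier j gt) r′j≡ri) (ℕₚ.<⇒≢ gt)
      r′j<r′i : r′ j ℕ.< r′ i
      r′j<r′i with ℕₚ.<-cmp (r′ i) (r i)
      ... | tri< lt _ _ = contradiction (sym (earlier′ i lt)) (ℕₚ.<⇒≢ lt)
      ... | tri≈ _ eq _ = contradiction (E′.injective (trans eq (sym r′j≡ri))) i≢j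
      ... | tri> _ _ gt = subst (ℕ._< r′ i) (sym r′j≡ri) gt
      j<i : j < i
      j<i with E.entered i
      ... | p , p~i , le = E′.greedy p~i
        (subst₂ ℕ._≤_ (time-earlier p le) (sym r′j≡ri) le) r′j<r′i
      i<j : i < j
      i<j with E′.entered j
      ... | p , p~j , le = E.greedy p~j (subst (ℕ._≤ r i) (sym (time-earlier′ p le′)) le′) ri<rj
        where le′ = subst (time r′ p ℕ.≤_) r′j≡ri le

  agree : ∀ t → Agree t
  agree = <-rec Agree λ t rec → go rec

-- Existence of an exploration of a connected graph

crossing : ∀ {A : Set} {_~_ : Rel A 0ℓ} {P : Pred A 0ℓ} → Decidable P → ∀ {x y} →
  Star _~_ x y → P x → ¬ P y → ∃ λ u → ∃ λ v → u ~ v × P u × ¬ P v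
crossing P? ε px ¬py = contradiction px ¬py
crossing P? (_◅_ {j = z} x~z z⋆y) px ¬py with P? z
... | yes pz = crossing P? z⋆y pz ¬py
... | no ¬pz = _ , _ , x~z , px , ¬pz

module Explore {n} (_~_ : Rel (Fin (suc n)) 0ℓ) (_~?_ : ∀ u v → Dec (u ~ v))
               (reach : ∀ v → Star _~_ zero v) where

  -- The vertices i with r i < k have been visited; the others carry r i = n.
  record Stage (k : ℕ) (r : Fin n → ℕ) : Set where
    field
      visited? : ∀ i → r i ℕ.< k ⊎ r i ≡ n
      injective : ∀ {i j} → r i ℕ.< k → r i ≡ r j → i ≡ j
      hits    : ∀ {t} → t ℕ.< k → ∃ λ i → r i ≡ t
      entered : ∀ i → r i ℕ.< k → ∃ λ p → p ~ suc i × time r p ℕ.≤ r i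
      greedy  : ∀ {p i j} → r j ℕ.< k → p ~ suc i → time r p ℕ.≤ r j → r j ℕ.< r i → j < i

  module Advance {k r} (k<n : k ℕ.< n) (stage : Stage k r) where
    open Stage stage

    -- By the shift in `time`, the bound `k` admits the root and the vertices with `r` below `k`,
    -- that is, all visited vertices.
    Frontier : Fin n → Set
    Frontier i = r i ≡ n × ∃ λ p → p ~ suc i × time r p ℕ.≤ k

    frontier? : Decidable Frontier
    frontier? i = (r i ℕ.≟ n) ×-dec any? λ p → (p ~? suc i) ×-dec (time r p ℕ.≤? k)

    unvisited : ∃ λ i → r i ≡ n
    unvisited with any? (λ i → r i ℕ.≟ n)
    ... | yes u = u
    -- Otherwise all `n` vertices would have distinct times below `k`, which is less than `n`.
    ... | no none = contradiction
      (injective⇒≤ {f = λ i → fromℕ< (all-visited i)} λ {i} {j} eq → injective (all-visited i)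
        (trans (sym (toℕ-fromℕ< (all-visited i))) (trans (cong toℕ eq) (toℕ-fromℕ< (all-visited j)))))
      (ℕₚ.<⇒≱ k<n)
      where
      all-visited : ∀ i → r i ℕ.< k
      all-visited i = [ (λ lt → lt) , (λ eq → contradiction (i , eq) none) ]′ (visited? i)

    frontier : ∃ Frontier
    frontier with unvisited
    -- A path from the root to the unvisited `v` must leave the visited set; the edge where it does
    -- so ends in the frontier.
    ... | v , rv≡n with crossing (λ x → time r x ℕ.≤? k) (reach (suc v)) z≤n
                          (λ le → ℕₚ.<⇒≱ (ℕₚ.m<n⇒m<1+n k<n) (subst (λ m → suc m ℕ.≤ k) rv≡n le))
    ...   | x , zero  , x~y , le , ¬le = contradiction z≤n ¬le
    ...   | x , suc i , x~y , le , ¬le =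
      i , [ (λ lt → contradiction lt ¬le) , (λ eq → eq) ]′ (visited? i) , x , x~y , le

    next : Fin n
    next = proj₁ (least frontier? frontier)

    next-frontier : Frontier next
    next-frontier = proj₁ (proj₂ (least frontier? frontier))

    next-least : ∀ j → Frontier j → next ≤ j
    next-least = proj₂ (proj₂ (least frontier? frontier))

    r⁺ : Fin n → ℕ
    r⁺ = updateAt r next (const k)

    r⁺-next : r⁺ next ≡ k
    r⁺-next = updateAt-updates next r

    r⁺-other : ∀ {x} → x ≢ next → r⁺ x ≡ r x
    r⁺-other {x} = updateAt-minimal x next r

    visited≢next : ∀ {x} → r x ℕ.≤ k → x ≢ next
    visited≢next le refl = ℕₚ.<⇒≱ k<n (subst (ℕ._≤ k) (proj₁ next-frontier) le)

    visited : ∀ {x} → r x ℕ.≤ k → r x ℕ.< k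
    visited {x} le = [ (λ lt → lt) , (λ eq → contradiction (subst (ℕ._≤ k) eq le) (ℕₚ.<⇒≱ k<n)) ]′ (visited? x)

    old-visited : ∀ {x} → x ≢ next → r⁺ x ℕ.< suc k → r x ℕ.< k
    old-visited x≢ (s≤s le) = visited (subst (ℕ._≤ k) (r⁺-other x≢) le)

    time⁺ : ∀ p → time r p ℕ.≤ k → time r⁺ p ≡ time r p
    time⁺ zero    _  = refl
    time⁺ (suc x) lt = cong suc (r⁺-other (visited≢next (ℕₚ.<⇒≤ lt)))

    time⁻ : ∀ p → time r⁺ p ℕ.≤ k → time r⁺ p ≡ time r p
    time⁻ zero    _  = refl
    time⁻ (suc x) lt = cong suc (r⁺-other λ { refl → ℕₚ.<-irrefl r⁺-next lt })

    stage⁺ : Stage (suc k) r⁺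
    stage⁺ = record
      { visited? = visited?⁺ ; injective = injective⁺ ; hits = hits⁺ ; entered = entered⁺ ; greedy = greedy⁺ }
      where
      visited?⁺ : ∀ i → r⁺ i ℕ.< suc k ⊎ r⁺ i ≡ n
      visited?⁺ i with i ≟ next
      ... | yes refl = inj₁ (s≤s (ℕₚ.≤-reflexive r⁺-next))
      ... | no i≢ rewrite r⁺-other i≢ = [ inj₁ ∘ ℕₚ.m<n⇒m<1+n , inj₂ ]′ (visited? i)

      injective⁺ : ∀ {i j} → r⁺ i ℕ.< suc k → r⁺ i ≡ r⁺ j → i ≡ j
      injective⁺ {i} {j} lt eq with i ≟ next | j ≟ next
      ... | yes refl | yes refl = refl
      ... | yes refl | no j≢ = contradiction (trans (sym (r⁺-other j≢)) (trans (sym eq) r⁺-next))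
        (ℕₚ.<⇒≢ (old-visited j≢ (subst (ℕ._< suc k) eq lt)))
      ... | no i≢ | yes refl = contradiction (trans (sym (r⁺-other i≢)) (trans eq r⁺-next))
        (ℕₚ.<⇒≢ (old-visited i≢ lt))
      ... | no i≢ | no j≢ = injective (old-visited i≢ lt)
        (trans (sym (r⁺-other i≢)) (trans eq (r⁺-other j≢)))

      hits⁺ : ∀ {t} → t ℕ.< suc k → ∃ λ i → r⁺ i ≡ t
      hits⁺ t<1+k with ℕₚ.m<1+n⇒m<n∨m≡n t<1+k
      ... | inj₂ refl = next , r⁺-next
      ... | inj₁ t<k with hits t<k
      ...   | i , refl = i , r⁺-other (visited≢next (ℕₚ.<⇒≤ t<k))

      entered⁺ : ∀ i → r⁺ i ℕ.< suc k → ∃ λ p → p ~ suc i × time r⁺ p ℕ.≤ r⁺ i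
      entered⁺ i lt with i ≟ next
      ... | yes refl = let p , p~ , le = proj₂ next-frontier in
        p , p~ , subst₂ ℕ._≤_ (sym (time⁺ p le)) (sym r⁺-next) le
      ... | no i≢ = let p , p~ , le = entered i (old-visited i≢ lt) in
        p , p~ , subst₂ ℕ._≤_ (sym (time⁺ p (ℕₚ.≤-trans le (ℕₚ.<⇒≤ (old-visited i≢ lt))))) (sym (r⁺-other i≢)) le

      greedy⁺ : ∀ {p i j} → r⁺ j ℕ.< suc k → p ~ suc i → time r⁺ p ℕ.≤ r⁺ j → r⁺ j ℕ.< r⁺ i → j < i
      greedy⁺ {p} {i} {j} lt p~i le j<i with i ≟ next | j ≟ next
      ... | yes refl | yes refl = contradiction refl (ℕₚ.<⇒≢ j<i)
      -- Here `i` was already available when `next` was chosen, so it lies in the frontier and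
      -- minimality of `next` applies.
      ... | no i≢ | yes refl = ≤∧≢⇒< (next-least i (ri≡n , p , p~i , subst (ℕ._≤ k) (time⁻ p le′) le′)) (i≢ ∘ sym)
        where
        le′ = subst (time r⁺ p ℕ.≤_) r⁺-next le
        ri≡n : r i ≡ n
        ri≡n = [ (λ ri<k → contradiction (subst₂ ℕ._<_ r⁺-next (r⁺-other i≢) j<i) (ℕₚ.<-asym ri<k))
               , (λ eq → eq) ]′ (visited? i)
      -- Before the update `next` carried the time `n`, later than `j`, so greediness of the
      -- previous stage applies.
      ... | yes refl | no j≢ = greedy rj<k p~i (subst₂ ℕ._≤_ (time⁻ p (ℕₚ.≤-trans le (ℕ.s≤s⁻¹ lt))) (r⁺-other j≢) le)
          (ℕₚ.<-trans rj<k (subst (k ℕ.<_) (sym (proj₁ next-frontier)) k<n))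
        where rj<k = old-visited j≢ lt
      ... | no i≢ | no j≢ = greedy (old-visited j≢ lt) p~i
        (subst₂ ℕ._≤_ (time⁻ p (ℕₚ.≤-trans le (ℕ.s≤s⁻¹ lt))) (r⁺-other j≢) le)
        (subst₂ ℕ._<_ (r⁺-other j≢) (r⁺-other i≢) j<i)

  stages : ∀ k → k ℕ.≤ n → ∃ (Stage k)
  stages zero _ = const n , record
    { visited? = λ _ → inj₂ refl ; injective = λ () ; hits = λ ()
    ; entered = λ _ () ; greedy = λ () }
  stages (suc k) k<n with stages k (ℕₚ.<⇒≤ k<n)
  ... | r , stage = r⁺ , stage⁺
    where open Advance k<n stage

  exploration : ∃ (Exploration _~_)
  exploration with stages n ℕₚ.≤-refl
  ... | r , stage = r , record
    { bounded   = bounded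
    ; injective = λ {i} → injective (bounded i)
    ; entered   = λ i → entered i (bounded i)
    ; greedy    = λ {_} {_} {j} → greedy (bounded j)
    }
    where
    open Stage stage
    visit : Fin n → Fin n
    visit t = proj₁ (hits (toℕ<n t))
    r-visit : ∀ t → r (visit t) ≡ toℕ t
    r-visit t = proj₂ (hits (toℕ<n t))
    bounded : ∀ i → r i ℕ.< n
    -- `visit` is a right inverse of `r`, hence injective and so onto: no vertex is left with the
    -- value `n`.
    bounded i with injective⇒strictlySurjective {f = visit}
                     (λ {t} {u} eq → toℕ-injective (trans (sym (r-visit t)) (trans (cong r eq) (r-visit u)))) i
    ... | t , refl = subst (ℕ._< n) (sym (r-visit t)) (toℕ<n t)

-- Trees given by parent functions

Endpoints : ℕ → Set
Endpoints n = Fin (suc n) × Fin (suc n)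

Ordered : ∀ {n} → Endpoints n → Set
Ordered (u , v) = u < v

-- An edge lists its smaller endpoint first, and the parent can be either one.
Joins : ∀ {n} → (Fin n → Fin (suc n)) → Fin n → Endpoints n → Set
Joins f i (u , v) = (u ≡ f i × v ≡ suc i) ⊎ (u ≡ suc i × v ≡ f i)

joins-cong : ∀ {n} {f g : Fin n → Fin (suc n)} → f ≗ g → ∀ {i e} → Joins f i e → Joins g i e
joins-cong f≗g (inj₁ (p , q)) = inj₁ (trans p (f≗g _) , q)
joins-cong f≗g (inj₂ (p , q)) = inj₂ (p , trans q (f≗g _))

joins-unique : ∀ {n} (f : Fin n → Fin (suc n)) {i e e′} → Ordered e → Ordered e′ →
  Joins f i e → Joins f i e′ → e ≡ e′
joins-unique _ _  _   (inj₁ (refl , refl)) (inj₁ (refl , refl)) = refl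
joins-unique _ lt lt′ (inj₁ (refl , refl)) (inj₂ (refl , refl)) = ⊥-elim (<-asym lt lt′)
joins-unique _ lt lt′ (inj₂ (refl , refl)) (inj₁ (refl , refl)) = ⊥-elim (<-asym lt lt′)
joins-unique _ _  _   (inj₂ (refl , refl)) (inj₂ (refl , refl)) = refl

Edge-≡ : ∀ {m} (G : SpanningSubgraph m) {e e′ : SpanningSubgraph.Edge G} → proj₁ e ≡ proj₁ e′ → e ≡ e′
Edge-≡ G {uv , p , x} {_ , q , y} refl =
  cong₂ (λ p x → uv , p , x) (<-irrelevant p q) (T-irrelevant x y)

module ParentFunction {n} (f : Fin n → Fin (suc n)) (r : Fin n → ℕ)
                      (older : ∀ i → time r (f i) ℕ.≤ r i) where

  -- Each of the two vertices would precede the other in time. Hence an edge determines which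
  -- endpoint is the child.
  not-mutual : ∀ {i j} → f i ≡ suc j → f j ≢ suc i
  not-mutual {i} {j} fi fj = ℕₚ.<-asym
    (subst (λ v → time r v ℕ.≤ r i) fi (older i)) (subst (λ v → time r v ℕ.≤ r j) fj (older j))

  f≢self : ∀ i → f i ≢ suc i
  f≢self i eq = not-mutual eq eq

  joins-injective : ∀ {i j e} → Joins f i e → Joins f j e → i ≡ j
  joins-injective (inj₁ (_ , p)) (inj₁ (_ , q)) = suc-injective (trans (sym p) q)
  joins-injective (inj₁ (p , q)) (inj₂ (p′ , q′)) = contradiction (trans (sym q′) q) (not-mutual (trans (sym p) p′))
  joins-injective (inj₂ (p , q)) (inj₁ (p′ , q′)) = contradiction (trans (sym p′) p) (not-mutual (trans (sym q) q′))
  joins-injective (inj₂ (p , _)) (inj₂ (q , _)) = suc-injective (trans (sym p) q)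

  parentEdge : (G : SpanningSubgraph (suc n)) → (∀ i → SpanningSubgraph._~_ G (f i) (suc i)) →
    ∀ i → Σ (SpanningSubgraph.Edge G) λ e → Joins f i (proj₁ e)
  parentEdge G f~ i with <-cmp (f i) (suc i)
  ... | tri< lt _ _ = (_ , lt , f~ i) , inj₁ (refl , refl)
  ... | tri≈ _ eq _ = contradiction eq (f≢self i)
  ... | tri> _ _ gt = (_ , gt , subst T (SpanningSubgraph.symmetric G _ _) (f~ i)) , inj₂ (refl , refl)

  Parent : Fin (suc n) → Fin (suc n) → Set
  Parent u zero    = ⊥
  Parent u (suc i) = f i ≡ u

  parent? : ∀ u v → Dec (Parent u v)
  parent? u zero    = no λ ()
  parent? u (suc i) = f i ≟ u

  parent-earlier : ∀ {u} v → Parent u v → time r u ℕ.< time r v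
  parent-earlier (suc i) refl = s≤s (older i)

  parent-functional : ∀ {u u′} v → Parent u v → Parent u′ v → u ≡ u′
  parent-functional (suc i) refl refl = refl

  graph : SpanningSubgraph (suc n)
  graph = record
    { adj       = λ u v → does (parent? u v) ∨ does (parent? v u)
    ; symmetric = λ u v → ∨-comm (does (parent? u v)) _
    ; loopless  = λ v → cong₂ _∨_ (dec-false (parent? v v) (irrefl v)) (dec-false (parent? v v) (irrefl v))
    }
    where
    irrefl : ∀ v → ¬ Parent v v
    irrefl v p = ℕₚ.<-irrefl refl (parent-earlier v p)

  open SpanningSubgraph graph

  adjacent⁻ : ∀ u v → u ~ v → Parent u v ⊎ Parent v u
  adjacent⁻ u v u~v with parent? u v | parent? v u
  ... | yes p | _     = inj₁ p
  ... | no _  | yes q = inj₂ q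

  adjacent⁺ : ∀ u v → Parent u v → u ~ v
  adjacent⁺ u v p = Equivalence.from T-∨ (inj₁ (Equivalence.from T-≡ (dec-true (parent? u v) p)))

  -- Times strictly decrease towards the root, so the bound `k` serves as fuel.
  toRoot : ∀ k v → time r v ℕ.≤ k → Star _~_ v zero
  toRoot k       zero    _        = ε
  toRoot (suc k) (suc i) (s≤s le) =
    subst T (symmetric (f i) (suc i)) (adjacent⁺ (f i) (suc i) refl) ◅ toRoot k (f i) (ℕₚ.≤-trans (older i) le)

  connected : Connected
  connected u v = toRoot _ u ℕₚ.≤-refl ◅◅ Star.reverse (λ {u} {v} → subst T (symmetric u v)) (toRoot _ v ℕₚ.≤-refl)

  -- Once a walk without backtracking goes down the tree, it never goes up again.
  descend : ∀ {x v} y zs → Parent x y → Linked _~_ (y ∷ zs ∷ʳ v) → Unique (x ∷ y ∷ zs) → All (v ≢_) (x ∷ y ∷ zs) →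
    time r y ℕ.< time r v × ∃ λ w → w ∈ y ∷ zs × Parent w v
  descend {x} {v} y [] x↑y (y~v ∷ _) _ (v≢x ∷ _) with adjacent⁻ y v y~v
  ... | inj₁ y↑v = parent-earlier v y↑v , y , here refl , y↑v
  -- Going up from `y` leads back to its parent `x`, which the distinctness of the vertices forbids.
  ... | inj₂ v↑y = contradiction (parent-functional y v↑y x↑y) v≢x
  descend y (z ∷ zs) x↑y (y~z ∷ walk) ((_ ∷ x≢z ∷ _) ∷ uniq) (_ ∷ v≢) with adjacent⁻ y z y~z
  ... | inj₂ z↑y = contradiction (parent-functional y x↑y z↑y) x≢z
  ... | inj₁ y↑z with descend z zs y↑z walk uniq v≢
  ...   | lt , w , w∈ , w↑v = ℕₚ.<-trans (parent-earlier z y↑z) lt , w , there w∈ , w↑v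

  -- Either the walk climbs all the way, and `v` is earlier than `x`, or it turns downwards
  -- somewhere, and from there `descend` shows that it enters `v` from the parent of `v`.
  ascend : ∀ {v} x y zs → Linked _~_ (x ∷ y ∷ zs ∷ʳ v) → Unique (x ∷ y ∷ zs) → All (v ≢_) (x ∷ y ∷ zs) →
    time r v ℕ.< time r x ⊎ ∃ λ w → w ∈ y ∷ zs × Parent w v
  ascend x y zs (x~y ∷ walk) uniq v≢ with adjacent⁻ x y x~y
  ... | inj₁ x↑y = inj₂ (proj₂ (descend y zs x↑y walk uniq v≢))
  ascend {v} x y [] (_ ∷ y~v ∷ _) _ _ | inj₂ y↑x with adjacent⁻ y v y~v
  ... | inj₁ y↑v = inj₂ (y , here refl , y↑v)
  ... | inj₂ v↑y = inj₁ (ℕₚ.<-trans (parent-earlier y v↑y) (parent-earlier x y↑x))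
  ascend x y (z ∷ zs) (_ ∷ walk) (_ ∷ uniq) (_ ∷ v≢) | inj₂ y↑x with ascend y z zs walk uniq v≢
  ... | inj₁ lt = inj₁ (ℕₚ.<-trans lt (parent-earlier x y↑x))
  ... | inj₂ (w , w∈ , w↑v) = inj₂ (w , there w∈ , w↑v)

  -- A cycle that starts downwards keeps descending and would end later than it began. One that
  -- starts upwards leaves `v` through its parent `x`; it cannot climb all the way back to `v`, so
  -- it returns through the parent again and repeats `x`.
  acyclic : Acyclic
  acyclic v [] record { nondegenerate = () }
  acyclic v (x ∷ []) record { nondegenerate = s≤s () }
  acyclic v (x ∷ y ∷ zs) record { distinct = v≢ ∷ uniq ; closedWalk = v~x ∷ x~y ∷ walk }
    with adjacent⁻ v x v~x
  ... | inj₁ v↑x with adjacent⁻ x y x~y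
  ...   | inj₁ x↑y = ℕₚ.<-asym (ℕₚ.<-trans (parent-earlier x v↑x) (parent-earlier y x↑y))
                               (proj₁ (descend y zs x↑y walk uniq v≢))
  ...   | inj₂ y↑x = All.head (All.tail v≢) (parent-functional x v↑x y↑x)
  acyclic v (x ∷ y ∷ zs) record { distinct = v≢ ∷ uniq@(x≢ ∷ _) ; closedWalk = v~x ∷ walk }
      | inj₂ x↑v with ascend x y zs walk uniq v≢
  ... | inj₁ lt = ℕₚ.<-asym lt (parent-earlier v x↑v)
  ... | inj₂ (w , w∈ , w↑v) = All.lookup x≢ w∈ (parent-functional v x↑v w↑v)

  parent⇒joins : ∀ {u} v → Parent u v → ∃ λ i → u ≡ f i × v ≡ suc i
  parent⇒joins (suc i) refl = i , refl , refl

  child : (e : Edge) → ∃ λ i → Joins f i (proj₁ e)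
  child ((u , v) , _ , u~v) with adjacent⁻ u v u~v
  ... | inj₁ u↑v = let i , p , q = parent⇒joins v u↑v in i , inj₁ (p , q)
  ... | inj₂ v↑u = let i , p , q = parent⇒joins u v↑u in i , inj₂ (q , p)

  module _ (π : Fin n → Fin n) (π-injective : Injective _≡_ _≡_ π) where

    labeledTree : EdgeLabeledSpanningTree (suc n)
    labeledTree = record
      { graph    = graph
      ; isTree   = connected , acyclic
      ; labeling = mk⤖ {to = λ e → π (proj₁ (child e))} (inj , strictlySurjective⇒surjective surj)
      }
      where
      inj : Injective _≡_ _≡_ λ e → π (proj₁ (child e))
      inj {e} {e′} eq = Edge-≡ graph (joins-unique f (proj₁ (proj₂ e)) (proj₁ (proj₂ e′)) (proj₂ (child e))
        (subst (λ i → Joins f i (proj₁ e′)) (sym (π-injective eq)) (proj₂ (child e′))))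
      surj : StrictlySurjective _≡_ λ e → π (proj₁ (child e))
      surj y with injective⇒strictlySurjective π-injective y
      ... | i , refl with parentEdge graph (λ i → adjacent⁺ (f i) (suc i) refl) i
      ...   | e , joins = e , cong π (joins-injective (proj₂ (child e)) joins)

    label-joins : ∀ e {i} → Joins f i (proj₁ e) → EdgeLabeledSpanningTree.label labeledTree e ≡ π i
    label-joins e joins = cong π (joins-injective (proj₂ (child e)) joins)

open ParentFunction using (labeledTree; label-joins)

-- By `label-joins` a label depends only on which `i` the edge joins to its parent, and the same `i`
-- works for both parent functions.
labeledTree-cong : ∀ {n} {f f′ : Fin n → Fin (suc n)} {r r′ older older′} {π π′ : Fin n → Fin n}
  {inj : Injective _≡_ _≡_ π} {inj′ : Injective _≡_ _≡_ π′} →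
  f ≗ f′ → π ≗ π′ → labeledTree f r older π inj ≈ᵗ labeledTree f′ r′ older′ π′ inj′
labeledTree-cong {n} {f} {f′} {r} {r′} {older} {older′} {π} {π′} {inj} {inj′} f≗f′ π≗π′ = record
  { sameAdj   = λ u v → cong₂ _∨_ (same-parent u v) (same-parent v u)
  ; sameLabel = λ e e′ e≡e′ → let i , joins = F.child e in
      trans (F.label-joins π inj e joins) (trans (π≗π′ i) (sym
        (F′.label-joins π′ inj′ e′ (joins-cong f≗f′ (subst (Joins f i) e≡e′ joins)))))
  }
  where
  module F  = ParentFunction f r older
  module F′ = ParentFunction f′ r′ older′
  same-parent : ∀ u v → does (F.parent? u v) ≡ does (F′.parent? u v)
  same-parent u zero    = refl
  same-parent u (suc i) = cong (λ x → does (x ≟ u)) (f≗f′ i)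

-- From parking functions to labeled trees

module FromParking {n} (a b : Vec (Fin n) n) (p : AllPark Subset.⊥ (zip a b)) where

  s : Fin n → Fin n
  s = spot p

  r : Fin n → ℕ
  r = toℕ ∘ s

  open Parks (spot-parks a b p) public

  r-injective : Injective _≡_ _≡_ r
  r-injective = injective ∘ toℕ-injective

  driver : ∀ t → ∃ λ i → s i ≡ t
  driver = injective⇒strictlySurjective injective

  -- Shifting the spots by one makes room for the root in front of them.
  occupant : (t : Fin n) → ∃ λ v → time r v ≡ toℕ t
  occupant zero    = zero , refl
  occupant (suc t) = let i , eq = driver (inject₁ t) in
    suc i , cong suc (trans (cong toℕ eq) (toℕ-inject₁ t))

  parent : Fin n → Fin (suc n)
  parent i = proj₁ (occupant (lookup a i))

  time-parent : ∀ i → time r (parent i) ≡ toℕ (lookup a i)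
  time-parent i = proj₂ (occupant (lookup a i))

  older : ∀ i → time r (parent i) ℕ.≤ r i
  older i = subst (ℕ._≤ r i) (sym (time-parent i)) (reachable i)

  open ParentFunction parent r older using (graph; adjacent⁻; adjacent⁺; parent-earlier) public
  open SpanningSubgraph graph using (_~_)

  code : Fin n → Fin n
  code t = lookup b (proj₁ (driver t))

  code-bounded : ∀ t → t ≤ code t
  code-bounded t with driver t
  ... | i , refl = willing i

  code-spot : ∀ i → code (s i) ≡ lookup b i
  code-spot i = cong (lookup b) (injective (proj₂ (driver (s i))))

  π : Fin n → Fin n
  π i = decode code (s i)

  π-injective : Injective _≡_ _≡_ π
  π-injective = injective ∘ decode-injective code

  tree : EdgeLabeledSpanningTree (suc n)
  tree = labeledTree parent r older π π-injective

  exploration : Exploration _~_ r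
  exploration = record
    { bounded   = toℕ<n ∘ s
    ; injective = r-injective
    ; entered   = λ i → parent i , adjacent⁺ (parent i) (suc i) refl , older i
    ; greedy    = λ {p} {i} {j} → greedy p i j
    }
    where
    greedy : ∀ p i j → p ~ suc i → time r p ℕ.≤ r j → r j ℕ.< r i → j < i
    greedy p i j p~i p≤j j<i with adjacent⁻ p (suc i) p~i
    -- If `p` were a child of `suc i`, it would come after `i` and hence after `j`.
    ... | inj₂ i↑p = contradiction (ℕₚ.≤-trans (ℕₚ.<⇒≤ (parent-earlier p i↑p)) p≤j) (ℕₚ.<⇒≱ (ℕₚ.m<n⇒m<1+n j<i))
    -- The spot of `j` lies between the preference of `i` and the spot of `i`, so car `i` found it
    -- taken by an earlier car.
    ... | inj₁ refl with first i (s j) (subst (ℕ._≤ r j) (time-parent i) p≤j) j<i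
    ...   | inj₁ s∈ = contradiction s∈ ∉⊥
    ...   | inj₂ (k , k<i , eq) = subst (_< i) (injective eq) k<i

-- Well-definedness and injectivity

module _ {n} {a b : Vec (Fin n) n} (p q : AllPark Subset.⊥ (zip a b)) where
  private
    module P = FromParking a b p
    module Q = FromParking a b q

  -- Equality in `IPF` ignores the parking witness, so the tree must not depend on it. By
  -- `parks-unique` both witnesses yield the same spots.
  tree-irrelevant : P.tree ≈ᵗ Q.tree
  tree-irrelevant = labeledTree-cong same-parent same-π
    where
    same-s : P.s ≗ Q.s
    same-s = parks-unique (spot-parks a b p) (spot-parks a b q)
    same-parent : P.parent ≗ Q.parent
    same-parent i = time-injective Q.r-injective (trans (sym (time-cong (cong toℕ ∘ same-s) (P.parent i)))
      (trans (P.time-parent i) (sym (Q.time-parent i))))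
    same-code : P.code ≗ Q.code
    same-code t with P.driver t
    ... | i , refl = trans (sym (Q.code-spot i)) (cong Q.code (sym (same-s i)))
    same-π : P.π ≗ Q.π
    same-π i = trans (decode-cong same-code (P.s i)) (cong (decode Q.code) (same-s i))

lookup-extensional : ∀ {A : Set} {n} {xs ys : Vec A n} → lookup xs ≗ lookup ys → xs ≡ ys
lookup-extensional {xs = xs} {ys} eq =
  trans (sym (tabulate∘lookup xs)) (trans (tabulate-cong eq) (tabulate∘lookup ys))

module _ {n} {a b a′ b′ : Vec (Fin n) n} (p : AllPark Subset.⊥ (zip a b)) (q : AllPark Subset.⊥ (zip a′ b′)) where
  private
    module P = FromParking a b p
    module Q = FromParking a′ b′ q
    module G = SpanningSubgraph P.graph
    module H = SpanningSubgraph Q.graph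

  -- Both visiting orders explore the same graph, so they coincide. The preferences are then the
  -- times of the parents, and the labels give the permutation, whose Lehmer code is `b` in the
  -- order of the spots.
  tree-determines : P.tree ≈ᵗ Q.tree → (a , b) ≡ (a′ , b′)
  tree-determines P≈Q = cong₂ _,_ (lookup-extensional same-a) (lookup-extensional same-b)
    where
    open _≈ᵗ_ P≈Q

    forward : ∀ u v → u G.~ v → u H.~ v
    forward u v = subst T (sameAdj u v)

    backward : ∀ u v → u H.~ v → u G.~ v
    backward u v = subst T (sym (sameAdj u v))

    same-r : P.r ≗ Q.r
    same-r = exploration-unique P.exploration record
      { bounded   = E.bounded
      ; injective = E.injective
      ; entered   = λ i → let u , u~i , le = E.entered i in u , backward u (suc i) u~i , le
      ; greedy    = λ {u} {i} u~i → E.greedy (forward u (suc i) u~i)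
      }
      where module E = Exploration Q.exploration

    same-s : P.s ≗ Q.s
    same-s = toℕ-injective ∘ same-r

    same-parent : P.parent ≗ Q.parent
    same-parent i with Q.adjacent⁻ (P.parent i) (suc i)
                         (forward (P.parent i) (suc i) (P.adjacent⁺ (P.parent i) (suc i) refl))
    ... | inj₁ eq = sym eq
    -- In this case `suc i` would come before `P.parent i` in the common order, against `P.older`.
    ... | inj₂ i↑ = contradiction
      (subst₂ ℕ._≤_ (time-cong same-r (P.parent i)) (same-r i) (P.older i))
      (ℕₚ.<⇒≱ (ℕₚ.<⇒≤ (Q.parent-earlier (P.parent i) i↑)))

    same-a : lookup a ≗ lookup a′
    same-a i = toℕ-injective (trans (sym (P.time-parent i)) (trans (time-cong same-r (P.parent i))
      (trans (cong (time Q.r) (same-parent i)) (Q.time-parent i))))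

    same-π : P.π ≗ Q.π
    same-π i =
      let e@(uv , u<v , u~v) , joins = ParentFunction.parentEdge P.parent P.r P.older P.graph
                  (λ i → P.adjacent⁺ (P.parent i) (suc i) refl) i
          e′ = uv , u<v , forward (proj₁ uv) (proj₂ uv) u~v
      in trans (sym (label-joins P.parent P.r P.older P.π P.π-injective e joins))
           (trans (sameLabel e e′ refl)
             (label-joins Q.parent Q.r Q.older Q.π Q.π-injective e′ (joins-cong same-parent joins)))

    same-code : P.code ≗ Q.code
    same-code = decode-determines P.code-bounded Q.code-bounded λ t → same-decode t (P.driver t)
      where
      same-decode : ∀ t → (∃ λ i → P.s i ≡ t) → decode P.code t ≡ decode Q.code t
      same-decode t (i , refl) = trans (same-π i) (cong (decode Q.code) (sym (same-s i)))

    same-b : lookup b ≗ lookup b′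
    same-b i = trans (sym (P.code-spot i)) (trans (same-code (P.s i))
      (trans (cong Q.code (same-s i)) (Q.code-spot i)))

-- From labeled trees to parking functions

parks-cong : ∀ {n m} {occupied : Subset n} {a a′ b b′ s : Fin m → Fin n} → a ≗ a′ → b ≗ b′ →
  Parks occupied a b s → Parks occupied a′ b′ s
parks-cong {s = s} a≗a′ b≗b′ P = record
  { free      = P.free
  ; injective = P.injective
  ; reachable = λ i → subst (_≤ s i) (a≗a′ i) (P.reachable i)
  ; willing   = λ i → subst (s i ≤_) (b≗b′ i) (P.willing i)
  ; first     = λ i t → P.first i t ∘ subst (_≤ t) (sym (a≗a′ i))
  }
  where module P = Parks P

module ToParking {n} (𝒯 : EdgeLabeledSpanningTree (suc n)) where
  module 𝒯 = EdgeLabeledSpanningTree 𝒯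
  open 𝒯 using (_~_; Edge; label)

  abstract
    found : ∃ (Exploration _~_)
    found = Explore.exploration _~_ (λ u v → T? (𝒯.adj u v)) (proj₁ 𝒯.isTree zero)

  r : Fin n → ℕ
  r = proj₁ found

  module E = Exploration (proj₂ found)

  parent : Fin n → Fin (suc n)
  parent i = proj₁ (E.entered i)

  parent~ : ∀ i → parent i ~ suc i
  parent~ i = proj₁ (proj₂ (E.entered i))

  older : ∀ i → time r (parent i) ℕ.≤ r i
  older i = proj₂ (proj₂ (E.entered i))

  module F = ParentFunction parent r older

  edge : ∀ i → Σ Edge λ e → Joins parent i (proj₁ e)
  edge = F.parentEdge 𝒯.graph parent~

  label-injective : Injective _≡_ _≡_ label
  label-injective = Bijection.injective 𝒯.labeling

  π : Fin n → Fin n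
  π i = label (proj₁ (edge i))

  π-injective : Injective _≡_ _≡_ π
  π-injective {i} {j} eq = F.joins-injective (proj₂ (edge i))
    (subst (λ e → Joins parent j (proj₁ e)) (sym (label-injective eq)) (proj₂ (edge j)))

  -- The labels leave room for only n edges, and the n edges from the
  -- vertices to their parents already use them up.
  every-edge : ∀ e → ∃ λ i → Joins parent i (proj₁ e) × label e ≡ π i
  every-edge e with injective⇒strictlySurjective π-injective (label e)
  ... | i , eq = i , subst (λ e → Joins parent i (proj₁ e)) (label-injective eq) (proj₂ (edge i)) , sym eq

  -- By `every-edge` the tree has no edges besides those from vertices to parents.
  rebuilt : labeledTree parent r older π π-injective ≈ᵗ 𝒯
  rebuilt = record
    { sameAdj   = λ u v → ⇔→≡ (mk⇔ (Equivalence.to T-≡ ∘ forward u v ∘ Equivalence.from T-≡)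
                                   (Equivalence.to T-≡ ∘ backward u v ∘ Equivalence.from T-≡))
    ; sameLabel = λ e e′ e≡e′ → let i , joins , eq = every-edge e′ in
        trans (F.label-joins π π-injective e (subst (Joins parent i) (sym e≡e′) joins)) (sym eq)
    }
    where
    module G = SpanningSubgraph F.graph

    parent⇒~ : ∀ u v → F.Parent u v → u ~ v
    parent⇒~ u (suc i) refl = parent~ i

    forward : ∀ u v → u G.~ v → u ~ v
    forward u v u~v with F.adjacent⁻ u v u~v
    ... | inj₁ u↑v = parent⇒~ u v u↑v
    ... | inj₂ v↑u = subst T (𝒯.symmetric v u) (parent⇒~ v u v↑u)

    backward-edge : ∀ u v → u < v → u ~ v → u G.~ v
    backward-edge u v u<v u~v with every-edge ((u , v) , u<v , u~v)
    ... | i , inj₁ (refl , refl) , _ = F.adjacent⁺ u v refl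
    ... | i , inj₂ (refl , refl) , _ = subst T (G.symmetric v u) (F.adjacent⁺ v u refl)

    backward : ∀ u v → u ~ v → u G.~ v
    backward u v u~v with <-cmp u v
    ... | tri< u<v _ _ = backward-edge u v u<v u~v
    ... | tri≈ _ refl _ = ⊥-elim (subst T (𝒯.loopless u) u~v)
    ... | tri> _ _ v<u = subst T (G.symmetric v u) (backward-edge v u v<u (subst T (𝒯.symmetric u v) u~v))

  s : Fin n → Fin n
  s i = fromℕ< (E.bounded i)

  r-s : ∀ i → toℕ (s i) ≡ r i
  r-s i = toℕ-fromℕ< (E.bounded i)

  s-injective : Injective _≡_ _≡_ s
  s-injective {i} {j} eq = E.injective (trans (sym (r-s i)) (trans (cong toℕ eq) (r-s j)))

  driver : ∀ t → ∃ λ i → s i ≡ t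
  driver = injective⇒strictlySurjective s-injective

  permutation : Fin n → Fin n
  permutation t = π (proj₁ (driver t))

  permutation-injective : Injective _≡_ _≡_ permutation
  permutation-injective {t} {u} eq =
    trans (sym (proj₂ (driver t))) (trans (cong s (π-injective eq)) (proj₂ (driver u)))

  permutation-s : ∀ i → permutation (s i) ≡ π i
  permutation-s i = cong π (s-injective (proj₂ (driver (s i))))

  abstract
    encoded : ∃ λ c → (∀ t → t ≤ c t) × decode c ≗ permutation
    encoded = encode permutation permutation-injective

  code : Fin n → Fin n
  code = proj₁ encoded

  preference<n : ∀ i → time r (parent i) ℕ.< n
  preference<n i = ℕₚ.≤-<-trans (older i) (E.bounded i)

  -- As spots count from zero, the time of the parent is the spot right after the parent's, and the
  -- first spot when the parent is the root.
  preference limit : Fin n → Fin n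
  preference i = fromℕ< (preference<n i)
  limit i = code (s i)

  toℕ-preference : ∀ i → toℕ (preference i) ≡ time r (parent i)
  toℕ-preference i = toℕ-fromℕ< (preference<n i)

  a b : Vec (Fin n) n
  a = tabulate preference
  b = tabulate limit

  parks : Parks Subset.⊥ (lookup a) (lookup b) s
  parks = parks-cong (sym ∘ lookup∘tabulate preference) (sym ∘ lookup∘tabulate limit) record
    { free      = λ _ → ∉⊥
    ; injective = s-injective
    ; reachable = λ i → subst₂ ℕ._≤_ (sym (toℕ-preference i)) (sym (r-s i)) (older i)
    ; willing   = λ i → proj₁ (proj₂ encoded) (s i)
    ; first     = λ i t a≤t t<s → inj₂ (first i t (driver t) a≤t t<s)
    }
    where
    first : ∀ i t → (∃ λ j → s j ≡ t) → preference i ≤ t → t < s i → ∃ λ j → j < i × s j ≡ t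
    -- Greediness of the exploration: `i` was available when `j` was visited, and `j` came first, so
    -- its label is smaller.
    first i t (j , refl) a≤t t<s = j ,
      E.greedy (parent~ i) (subst₂ ℕ._≤_ (toℕ-preference i) (r-s j) a≤t) (subst₂ ℕ._<_ (r-s j) (r-s i) t<s) , refl

  allPark : AllPark Subset.⊥ (zip a b)
  allPark = parks⇒allPark a b parks

  -- Surjectivity between setoids concerns every representative of the preimage, hence an arbitrary
  -- witness `p`; its spots are again `s` by `parks-unique`.
  tree≈ : (p : AllPark Subset.⊥ (zip a b)) → FromParking.tree a b p ≈ᵗ 𝒯
  tree≈ p = Setoid.trans (𝓕ᵉ (suc n)) {P.tree} {labeledTree parent r older π π-injective} {𝒯}
              (labeledTree-cong same-parent same-π) rebuilt
    where
    module P = FromParking a b p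

    same-s : P.s ≗ s
    same-s = parks-unique (spot-parks a b p) parks

    same-r : P.r ≗ r
    same-r i = trans (cong toℕ (same-s i)) (r-s i)

    same-parent : P.parent ≗ parent
    same-parent i = time-injective E.injective (trans (sym (time-cong same-r (P.parent i)))
      (trans (P.time-parent i) (trans (cong toℕ (lookup∘tabulate preference i)) (toℕ-preference i))))

    same-code : P.code ≗ code
    same-code t = at-spot t (P.driver t)
      where
      at-spot : ∀ t → (∃ λ i → P.s i ≡ t) → P.code t ≡ code t
      at-spot t (i , refl) = trans (P.code-spot i) (trans (lookup∘tabulate limit i) (cong code (sym (same-s i))))

    same-π : P.π ≗ π
    same-π i = trans (decode-cong same-code (P.s i)) (trans (cong (decode code) (same-s i))
      (trans (proj₂ (proj₂ encoded) (s i)) (permutation-s i)))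

theorem4p5 : (n : ℕ) → n ≥ 1 → Bijection (IPF n n) (𝓕ᵉ (suc n))
theorem4p5 n _ = record
  { to        = λ ((a , b) , p) → FromParking.tree a b p
  ; cong      = λ { {_ , p} {_ , q} refl → tree-irrelevant p q }
  ; bijective = (λ { {_ , p} {_ , q} → tree-determines p q })
              , λ 𝒯 → ((ToParking.a 𝒯 , ToParking.b 𝒯) , ToParking.allPark 𝒯)
                    , λ { {_ , p} refl → ToParking.tree≈ 𝒯 p }
  }
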